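{- Let $\mathcal C$ be a class of graphs with universally bounded merge-width. Then there is a class $\mathcal D$ of graphs of bounded expansion such that every $G\in\mathcal C$ is $(13,12)$-quasi-isometric to some $H\in\mathcal D$.
   Context: Graphs are finite, simple, undirected. For a partition $\mathcal P$ of $V(G)$ and $X\subseteq V(G)$, $X/\mathcal P$ is the set of parts intersecting $X$. For $R\subseteq\binom{V(G)}2$, $\mathrm{Ball}^r_R(v)$ is the radius-$r$ ball in $(V(G),R)$. $\mathcal P$ is homogeneous modulo $R$ if for all parts $X,Y$ (possibly equal), the pairs $\{x,y\}$, $x\in X,y\in Y,x\neq y$, not in $R$ are all edges of $G$ or all non-edges. A merge sequence for $G$ is $(\mathcal P_1,R_1),\dots,(\mathcal P_m,R_m)$ with $\mathcal P_1\preceq\dots\preceq\mathcal P_m$ partitions of $V(G)$, $\mathcal P_1$ into singletons, $\mathcal P_m=\{V(G)\}$, $R_1\subseteq\dots\subseteq R_m$, $\mathcal P_t$ homogeneous modulo $R_t$; its radius-$r$ width is $\max_{t<m}\max_v|\mathrm{Ball}^r_{R_{t+1}}(v)/\mathcal P_t|$. A class $\mathcal C$ has universally bounded merge-width if there is $f:\mathbb N\to\mathbb N$ such that every $G\in\mathcal C$ has a single merge sequence whose radius-$r$ width is at most $f(r)$ for every $r\in\mathbb N$. For a total order $<$ on $V(H)$, $u$ is strongly $r$-reachable from $v\ge u$ if there is a path of length at most $r$ from $v$ to $u$ all of whose internal vertices $w$ satisfy $w>v$; $\mathrm{scol}_r(H)$ is the minimum over orders of the maximum over $v$ of the number of vertices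 strongly $r$-reachable from $v$. A class $\mathcal D$ has bounded expansion iff $\sup_{H\in\mathcal D}\mathrm{scol}_r(H)<\infty$ for every $r$. A map $\phi:V(G)\to V(H)$ is an $(a,b)$-quasi-isometry if $\frac1a\mathrm{dist}_G(x,x')-b\le\mathrm{dist}_H(\phi(x),\phi(x'))\le a\,\mathrm{dist}_G(x,x')+b$ for all $x,x'$, and every $y\in V(H)$ has some $x$ with $\mathrm{dist}_H(y,\phi(x))\le b$; $G$ is $(a,b)$-quasi-isometric to $H$ if such a map exists. -}

module Defs where

open import Data.Nat using (ℕ; zero; suc; _+_; _*_; _≤_; _<_)
open import Data.Bool using (Bool; true; false; _∧_; _∨_; not; T)
open import Data.Fin using (Fin)
import Data.Fin as Fin
open import Data.List using (List; length; filterᵇ; allFin)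
open import Data.Bool.ListAction using (any)
open import Data.Product using (Σ; ∃; _×_; _,_)
open import Relation.Nullary.Decidable using (⌊_⌋)
open import Relation.Binary.PropositionalEquality using (_≡_; _≢_)
open import Function.Definitions using (Injective)

record Graph : Set where
  field
    n      : ℕ
    adj    : Fin n → Fin n → Bool
    sym    : ∀ x y → adj x y ≡ adj y x
    irrefl : ∀ x → adj x x ≡ false
open Graph public

GraphClass : Set₁
GraphClass = Graph → Set

_==_ : ∀ {n} → Fin n → Fin n → Bool
x == y = ⌊ x Fin.≟ y ⌋

count : ∀ {n} → (Fin n → Bool) → ℕ
count {n} p = length (filterᵇ p (allFin n))

anyV : ∀ {n} → (Fin n → Bool) → Bool
anyV {n} p = any p (allFin n)

-- Sets of unordered pairs R ⊆ (V choose 2).  A relation R : Fin n → Fin n → Bool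
-- represents the set {{x,y} : x ≠ y, R x y ∨ R y x}; every such set of pairs
-- arises this way.

PairSet : ℕ → Set
PairSet n = Fin n → Fin n → Bool

inR : ∀ {n} → PairSet n → Fin n → Fin n → Bool
inR R x y = R x y ∨ R y x

reach : ∀ {n} → PairSet n → ℕ → Fin n → Fin n → Bool
reach E zero    v u = v == u
reach E (suc r) v u = reach E r v u ∨ anyV (λ w → reach E r v w ∧ inR E w u)

Ball : ∀ {n} → PairSet n → ℕ → Fin n → Fin n → Bool
Ball R r v = reach R r v

-- Partitions: a partition of Fin n is given by a labelling of vertices;
-- parts are the nonempty fibres.

Partition : ℕ → Set
Partition n = Fin n → Fin n

samePart : ∀ {n} → Partition n → Fin n → Fin n → Set
samePart P x y = P x ≡ P y

partsMeeting : ∀ {n} → (Fin n → Bool) → Partition n → ℕ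
partsMeeting X P = count (λ ℓ → anyV (λ x → X x ∧ (P x == ℓ)))

Refines : ∀ {n} → Partition n → Partition n → Set
Refines P Q = ∀ x y → samePart P x y → samePart Q x y

Singletons : ∀ {n} → Partition n → Set
Singletons P = ∀ x y → samePart P x y → x ≡ y

Whole : ∀ {n} → Partition n → Set
Whole P = ∀ x y → samePart P x y

Homogeneous : (G : Graph) → Partition (n G) → PairSet (n G) → Set
Homogeneous G P R =
  ∀ x y x' y' → x ≢ y → x' ≢ y' →
  samePart P x x' → samePart P y y' →
  inR R x y ≡ false → inR R x' y' ≡ false →
  adj G x y ≡ adj G x' y'

-- Merge sequences (P_1,R_1),…,(P_m,R_m), indexed here by t = 0,…,m-1.

record MergeSeq (G : Graph) : Set where
  field
    m      : ℕ
    P      : ℕ → Partition (n G)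
    R      : ℕ → PairSet (n G)
    m≥1    : 1 ≤ m
    first  : Singletons (P 0)
    last   : ∀ t → suc t ≡ m → Whole (P t)
    monoP  : ∀ t → suc t < m → Refines (P t) (P (suc t))
    monoR  : ∀ t → suc t < m → ∀ x y → T (inR (R t) x y) → T (inR (R (suc t)) x y)
    homog  : ∀ t → t < m → Homogeneous G (P t) (R t)
open MergeSeq public

WidthAtMost : {G : Graph} → MergeSeq G → ℕ → ℕ → Set
WidthAtMost {G} S r k =
  ∀ t → suc t < m S → ∀ (v : Fin (n G)) →
  partsMeeting (Ball (R S (suc t)) r v) (P S t) ≤ k

UniversallyBoundedMergeWidth : GraphClass → Set
UniversallyBoundedMergeWidth 𝒞 =
  Σ (ℕ → ℕ) λ f → ∀ G → 𝒞 G →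
    Σ (MergeSeq G) λ S → ∀ r → WidthAtMost S r (f r)

-- Strong colouring numbers and bounded expansion.
-- A total order on Fin n is given by an injective ranking σ : Fin n → Fin n
-- (u < v iff σ u < σ v).

module _ (H : Graph) (σ : Fin (n H) → Fin (n H)) where
  private
    _≤σ_ : Fin (n H) → Fin (n H) → Bool
    u ≤σ v = ⌊ σ u Fin.≤? σ v ⌋
    _>σ_ : Fin (n H) → Fin (n H) → Bool
    w >σ v = ⌊ σ v Fin.<? σ w ⌋

  inner : Fin (n H) → ℕ → Fin (n H) → Bool
  inner v zero    w = v == w
  inner v (suc k) w = inner v k w ∨ ((w >σ v) ∧ anyV (λ x → inner v k x ∧ adj H x w))

  sreach : ℕ → Fin (n H) → Fin (n H) → Bool
  sreach zero    v u = v == u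
  sreach (suc r) v u = (u ≤σ v) ∧ ((v == u) ∨ anyV (λ x → inner v r x ∧ adj H x u))

ScolAtMost : ℕ → Graph → ℕ → Set
ScolAtMost r H c =
  Σ (Fin (n H) → Fin (n H)) λ σ → Injective _≡_ _≡_ σ ×
    (∀ v → count (sreach H σ r v) ≤ c)

BoundedExpansion : GraphClass → Set
BoundedExpansion 𝒟 = ∀ r → Σ ℕ λ c → ∀ H → 𝒟 H → ScolAtMost r H c

-- Quasi-isometries (a, b natural numbers).  dist ≤ k is  reach (adj G) k;
-- distances may be ∞ (disconnected graphs), with the usual conventions.

DistLe : (G : Graph) → ℕ → Fin (n G) → Fin (n G) → Bool
DistLe G k x y = reach (adj G) k x y

-- (1/a) d_G(x,x') - b ≤ d_H(φx,φx')  ⇔  d_G(x,x') ≤ a (d_H(φx,φx') + b)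
-- d_H(φx,φx') ≤ a d_G(x,x') + b
-- every y within distance b of the image
IsQuasiIsometry : ℕ → ℕ → (G H : Graph) → (Fin (n G) → Fin (n H)) → Set
IsQuasiIsometry a b G H φ =
  (∀ x x' k → T (DistLe H k (φ x) (φ x')) → T (DistLe G (a * (k + b)) x x')) ×
  (∀ x x' k → T (DistLe G k x x') → T (DistLe H (a * k + b) (φ x) (φ x'))) ×
  (∀ y → ∃ λ x → T (DistLe H b y (φ x)))

QuasiIsometric : ℕ → ℕ → Graph → Graph → Set
QuasiIsometric a b G H = Σ (Fin (n G) → Fin (n H)) (IsQuasiIsometry a b G H)

{-# OPTIONS --safe #-}
module Submission where

-- Reverse time, so that partitions get finer and red pairs disappear.  A vertex is live at step j if one of its
-- G-neighbours is at red distance more than 3.  By homogeneity, two live vertices x, x′ of one part at G-distance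
-- more than 2 have their whole part inside the G-balls of radius 2 around them: if z is red to the neighbours y, y′
-- witnessing that x, x′ are live, then x y′ z y is a red walk of length 3.  So the live vertices of a part are within
-- G-distance 2 of two hubs.  Hubs are kept while they remain within distance 4 of all live vertices, and every vertex
-- is contracted to a hub of its part at the step where it becomes live; H is the resulting quotient of G.
--
-- Classes have G-diameter at most 8, which gives the quasi-isometry.  Order the classes by the birth of their hubs.
-- At the step before the birth of a class no vertex of it is live, so all edges leaving it have red length at most 3
-- and its red diameter is at most 6; a strong r-walk in H thus stays in a red ball of radius 9r, which meets boundedly
-- many parts.  Each part meets at most 6 older classes, since its pair of hubs changes at most twice once it contains
-- a live vertex.

open import Defs renaming (sym to adj-sym)
open import Data.Bool using (Bool; true; false; T; T?; _∨_; _∧_; if_then_else_)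
open import Data.Bool.Properties using (T-∧; T-∨; ∨-comm)
open import Data.Fin using (Fin; zero; suc; toℕ; fromℕ<)
import Data.Fin as Fin
open import Data.Fin.Properties using (any?; all?; toℕ<n; toℕ-injective; toℕ-fromℕ<)
open import Data.List using (List; []; _∷_; _++_; length; map; concatMap; filterᵇ; allFin; lookup; tabulate; deduplicate)
open import Data.List.Properties using (length-++; length-map; length-tabulate)
open import Data.List.Membership.Propositional using (_∈_; lose)
open import Data.List.Membership.Propositional.Properties using (∈-allFin; ∈-filter⁺; ∈-filter⁻; ∈-map⁻; ∈-++⁺ˡ; ∈-++⁺ʳ; ∈-++⁻; ∈-∃++; ∈-concatMap⁺; ∈-tabulate⁺; ∈-tabulate⁻; ∈-deduplicate⁺; ∈-deduplicate⁻; ∈-lookup)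
open import Data.List.Relation.Unary.All using ([]; _∷_)
import Data.List.Relation.Unary.All as All
open import Data.List.Relation.Unary.Any using (here; there; index; satisfied)
open import Data.List.Relation.Unary.Any.Properties using (any⁺; any⁻; lookup-index)
open import Data.List.Relation.Unary.AllPairs using ([]; _∷_)
open import Data.List.Relation.Unary.Unique.Propositional using (Unique)
open import Data.List.Relation.Unary.Unique.Propositional.Properties using (allFin⁺; filter⁺; map⁺)
import Data.List.Relation.Unary.Unique.DecPropositional.Properties as DecUnique
open import Data.Nat using (ℕ; zero; suc; _+_; _*_; _∸_; _≤_; _<_; z≤n; s≤s; s≤s⁻¹; _≤?_; _<?_)
open import Data.Nat.Properties
open import Data.Product using (Σ; ∃; _×_; _,_; proj₁; proj₂)
open import Data.Product.Properties using (≡-dec)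
open import Data.Sum using (_⊎_; inj₁; inj₂)
import Data.Sum as Sum
open import Function using (_∘_; id; Equivalence; mk⇔)
open import Function.Definitions using (Injective)
open import Relation.Binary.Definitions using (DecidableEquality; tri<; tri≈; tri>)
open import Relation.Binary.PropositionalEquality hiding ([_])
open import Relation.Nullary using (¬_; Dec; yes; no; contradiction)
open import Relation.Nullary.Decidable using (⌊_⌋; does; toWitness; fromWitness; decidable-stable; dec-false; does-⇔; isYes≗does; map′; ¬?; _×-dec_; _⊎-dec_; _→-dec_)
open import Relation.Unary using (Decidable)

-- Counting

Unique-⊆-length : ∀ {a} {A : Set a} {xs ys : List A} →
  Unique xs → (∀ {x} → x ∈ xs → x ∈ ys) → length xs ≤ length ys
Unique-⊆-length [] _ = z≤n
Unique-⊆-length {xs = x ∷ xs} (x∉ ∷ u) sub with ∈-∃++ (sub (here refl))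
... | as , bs , refl = begin
  suc (length xs)            ≤⟨ s≤s (Unique-⊆-length u sub′) ⟩
  suc (length (as ++ bs))    ≡⟨ cong suc (length-++ as) ⟩
  suc (length as + length bs) ≡⟨ +-suc (length as) (length bs) ⟨
  length as + suc (length bs) ≡⟨ length-++ as ⟨
  length (as ++ x ∷ bs)      ∎
  where
  open ≤-Reasoning
  sub′ : ∀ {y} → y ∈ xs → y ∈ as ++ bs
  sub′ y∈ with ∈-++⁻ as (sub (there y∈))
  ... | inj₁ y∈as         = ∈-++⁺ˡ y∈as
  ... | inj₂ (here refl)  = contradiction refl (All.lookup x∉ y∈)
  ... | inj₂ (there y∈bs) = ∈-++⁺ʳ as y∈bs

Unique-lookup-injective : ∀ {a} {A : Set a} {xs : List A} → Unique xs →
  ∀ {i j} → lookup xs i ≡ lookup xs j → i ≡ j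
Unique-lookup-injective (x∉ ∷ u) {zero}  {zero}  eq = refl
Unique-lookup-injective (x∉ ∷ u) {zero}  {suc j} eq = contradiction eq (All.lookup x∉ (∈-lookup j))
Unique-lookup-injective (x∉ ∷ u) {suc i} {zero}  eq = contradiction (sym eq) (All.lookup x∉ (∈-lookup i))
Unique-lookup-injective (x∉ ∷ u) {suc i} {suc j} eq = cong suc (Unique-lookup-injective u eq)

length-concatMap-≤ : ∀ {a b} {A : Set a} {B : Set b} (f : A → List B) k →
  (∀ x → length (f x) ≤ k) → ∀ xs → length (concatMap f xs) ≤ k * length xs
length-concatMap-≤ f k f≤ [] = z≤n
length-concatMap-≤ f k f≤ (x ∷ xs) = begin
  length (f x ++ concatMap f xs)        ≡⟨ length-++ (f x) ⟩
  length (f x) + length (concatMap f xs) ≤⟨ +-mono-≤ (f≤ x) (length-concatMap-≤ f k f≤ xs) ⟩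
  k + k * length xs                      ≡⟨ *-suc k (length xs) ⟨
  k * suc (length xs)                    ∎
  where open ≤-Reasoning

module _ {n : ℕ} (p : Fin n → Bool) where

  ∈-selected⁺ : ∀ {x} → T (p x) → x ∈ filterᵇ p (allFin n)
  ∈-selected⁺ = ∈-filter⁺ (T? ∘ p) (∈-allFin _)

  ∈-selected⁻ : ∀ {x} → x ∈ filterᵇ p (allFin n) → T (p x)
  ∈-selected⁻ x∈ = proj₂ (∈-filter⁻ (T? ∘ p) {xs = allFin n} x∈)

  selected-unique : Unique (filterᵇ p (allFin n))
  selected-unique = filter⁺ (T? ∘ p) (allFin⁺ n)

  count-≤-length : ∀ {a} {A : Set a} {g : Fin n → A} → Injective _≡_ _≡_ g →
    (ys : List A) → (∀ x → T (p x) → g x ∈ ys) → count p ≤ length ys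
  count-≤-length {g = g} inj ys sub =
    subst (_≤ length ys) (length-map g (filterᵇ p (allFin n)))
      (Unique-⊆-length (map⁺ inj selected-unique) sub′)
    where
    sub′ : ∀ {y} → y ∈ map g (filterᵇ p (allFin n)) → y ∈ ys
    sub′ y∈ with x , x∈ , refl ← ∈-map⁻ g y∈ = sub x (∈-selected⁻ x∈)

count-< : ∀ {n} (p q : Fin n → Bool) → (∀ x → T (p x) → T (q x)) →
  ∀ z → T (q z) → ¬ T (p z) → count p < count q
count-< p q p⊆q z qz ¬pz = Unique-⊆-length
  (All.tabulate (λ { y∈ refl → ¬pz (∈-selected⁻ p y∈) }) ∷ selected-unique p)
  λ { (here refl) → ∈-selected⁺ q qz ; (there y∈) → ∈-selected⁺ q (p⊆q _ (∈-selected⁻ p y∈)) }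

anyV⁺ : ∀ {n} (p : Fin n → Bool) x → T (p x) → T (anyV p)
anyV⁺ p x px = any⁺ p (lose (∈-allFin x) px)

anyV⁻ : ∀ {n} (p : Fin n → Bool) → T (anyV p) → ∃ λ x → T (p x)
anyV⁻ {n} p h = satisfied (any⁻ p (allFin n) h)

-- A linear order refining a weight function

module _ {n : ℕ} (weight : Fin n → ℕ) where

  private
    -- Since `toℕ v < n`, keys compare weights first and break ties by the index.
    key : Fin n → ℕ
    key v = weight v * n + toℕ v

    key-reflects-≤ : ∀ u v → key u ≤ key v → weight u ≤ weight v
    key-reflects-≤ u v ku≤kv with weight u ≤? weight v
    ... | yes le = le
    ... | no  gt = contradiction (<-≤-trans kv<ku ku≤kv) (n≮n (key v))
      where
      open ≤-Reasoning
      kv<ku : key v < key u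
      kv<ku = begin-strict
        weight v * n + toℕ v <⟨ +-monoʳ-< (weight v * n) (toℕ<n v) ⟩
        weight v * n + n     ≡⟨ +-comm (weight v * n) n ⟩
        suc (weight v) * n   ≤⟨ *-monoˡ-≤ n (≰⇒> gt) ⟩
        weight u * n         ≤⟨ m≤m+n _ (toℕ u) ⟩
        weight u * n + toℕ u ∎

    key-injective : ∀ u v → key u ≡ key v → u ≡ v
    key-injective u v eq = toℕ-injective (+-cancelˡ-≡ (weight v * n) _ _
      (trans (cong (λ w → w * n + toℕ u) (sym same)) eq))
      where
      same : weight u ≡ weight v
      same = ≤-antisym (key-reflects-≤ u v (≤-reflexive eq)) (key-reflects-≤ v u (≤-reflexive (sym eq)))

    below : Fin n → Fin n → Bool
    below v u = ⌊ key u <? key v ⌋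

    below-< : ∀ u v → key u < key v → count (below u) < count (below v)
    below-< u v lt = count-< (below u) (below v)
      (λ x h → fromWitness (<-trans (toWitness h) lt)) u (fromWitness lt)
      (λ h → n≮n (key u) (toWitness h))

    below-bounded : ∀ v → count (below v) < n
    below-bounded v = <-≤-trans
      (count-< (below v) (λ _ → true) _ v _ (λ h → n≮n (key v) (toWitness h)))
      (≤-trans (count-≤-length _ id (allFin n) (λ x _ → ∈-allFin x))
               (≤-reflexive (length-tabulate id)))

  abstract
    rank : Fin n → Fin n
    rank v = fromℕ< (below-bounded v)

  private abstract
    toℕ-rank : ∀ v → toℕ (rank v) ≡ count (below v)
    toℕ-rank v = toℕ-fromℕ< (below-bounded v)

  rank-injective : Injective _≡_ _≡_ rank
  rank-injective {u} {v} eq with <-cmp (key u) (key v)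
  ... | tri≈ _ same _ = key-injective u v same
  ... | tri< lt _ _ = contradiction (below-< u v lt)
    (<-irrefl (trans (sym (toℕ-rank u)) (trans (cong toℕ eq) (toℕ-rank v))))
  ... | tri> _ _ gt = contradiction (below-< v u gt)
    (<-irrefl (trans (sym (toℕ-rank v)) (trans (cong toℕ (sym eq)) (toℕ-rank u))))

  rank-reflects-≤ : ∀ u v → rank u Fin.≤ rank v → weight u ≤ weight v
  rank-reflects-≤ u v le with key u ≤? key v
  ... | yes ku≤kv = key-reflects-≤ u v ku≤kv
  ... | no  ku≰kv = contradiction (below-< v u (≰⇒> ku≰kv))
    (≤⇒≯ (subst₂ _≤_ (toℕ-rank u) (toℕ-rank v) le))

-- Quotients of finite sets

record Quotient {n : ℕ} {A : Set} (f : Fin n → A) : Set where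
  field
    size            : ℕ
    class           : Fin n → Fin size
    label           : Fin size → A
    label-injective : Injective _≡_ _≡_ label
    label-class     : ∀ x → label (class x) ≡ f x
    member          : Fin size → Fin n
    class-member    : ∀ i → class (member i) ≡ i

quotient : ∀ {n} {A : Set} → DecidableEquality A → (f : Fin n → A) → Quotient f
quotient {n} {A} _≟_ f = record
  { size            = length labels
  ; class           = class
  ; label           = lookup labels
  ; label-injective = lookup-inj
  ; label-class     = λ x → sym (lookup-index (present x))
  ; member          = λ i → proj₁ (source i)
  ; class-member    = λ i → lookup-inj
      (trans (sym (lookup-index (present (proj₁ (source i))))) (sym (proj₂ (source i))))
  }
  where
  labels : List A
  labels = deduplicate _≟_ (tabulate f)
  lookup-inj : Injective _≡_ _≡_ (lookup labels)
  lookup-inj = Unique-lookup-injective (DecUnique.deduplicate-! _≟_ (tabulate f))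
  present : ∀ x → f x ∈ labels
  present x = ∈-deduplicate⁺ _≟_ (∈-tabulate⁺ x)
  class : Fin n → Fin (length labels)
  class x = index (present x)
  source : ∀ i → ∃ λ x → lookup labels i ≡ f x
  source i = ∈-tabulate⁻ (∈-deduplicate⁻ _≟_ (tabulate f) (∈-lookup i))

-- Walks

inR-sym : ∀ {n} (E : PairSet n) {x y} → T (inR E x y) → T (inR E y x)
inR-sym E {x} {y} = subst T (∨-comm (E x y) (E y x))

-- The index bounds the length, which may be smaller.
data Walk {n} (E : PairSet n) : ℕ → Fin n → Fin n → Set where
  []   : ∀ {k x} → Walk E k x x
  _∷ʳ_ : ∀ {k x y z} → Walk E k x y → T (inR E y z) → Walk E (suc k) x z

module _ {n} {E : PairSet n} where

  weaken : ∀ {k l x y} → k ≤ l → Walk E k x y → Walk E l x y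
  weaken _         []       = []
  weaken (s≤s k≤l) (w ∷ʳ e) = weaken k≤l w ∷ʳ e

  infixr 5 _◅◅_
  _◅◅_ : ∀ {k l x y z} → Walk E k x y → Walk E l y z → Walk E (k + l) x z
  w ◅◅ []       = weaken (m≤m+n _ _) w
  _◅◅_ {k} {x = x} {z = z} w (_∷ʳ_ {l} v e) = subst (λ i → Walk E i x z) (sym (+-suc k l)) ((w ◅◅ v) ∷ʳ e)

  edge : ∀ {x y} → T (inR E x y) → Walk E 1 x y
  edge e = [] ∷ʳ e

  reverse : ∀ {k x y} → Walk E k x y → Walk E k y x
  reverse []       = []
  reverse (w ∷ʳ e) = edge (inR-sym E e) ◅◅ reverse w

  reach⇒walk : ∀ k {x y} → T (reach E k x y) → Walk E k x y
  reach⇒walk zero    {x} {y} h with refl ← toWitness {a? = x Fin.≟ y} h = []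
  reach⇒walk (suc k) {x} {y} h with Equivalence.to (T-∨ {reach E k x y}) h
  ... | inj₁ h′ = weaken (n≤1+n k) (reach⇒walk k h′)
  ... | inj₂ h′ with w , h″ ← anyV⁻ (λ w → reach E k x w ∧ inR E w y) h′
                with a , e ← Equivalence.to (T-∧ {reach E k x w}) h″ = reach⇒walk k a ∷ʳ e

  walk⇒reach : ∀ {k x y} → Walk E k x y → T (reach E k x y)
  walk⇒reach {zero}  []       = fromWitness refl
  walk⇒reach {suc k} {x} []   = Equivalence.from (T-∨ {reach E k x x}) (inj₁ (walk⇒reach {k} []))
  walk⇒reach {suc k} {x} {z} (_∷ʳ_ {y = y} w e) =
    Equivalence.from (T-∨ {reach E k x z}) (inj₂ (anyV⁺ (λ y → reach E k x y ∧ inR E y z) y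
      (Equivalence.from (T-∧ {reach E k x y}) (walk⇒reach w , e))))

abstract
  walk? : ∀ {n} (E : PairSet n) k x y → Dec (Walk E k x y)
  walk? E k x y = map′ (reach⇒walk k) walk⇒reach (T? (reach E k x y))

mapWalk : ∀ {n} {E F : PairSet n} → (∀ x y → T (inR E x y) → T (inR F x y)) →
  ∀ {k x y} → Walk E k x y → Walk F k x y
mapWalk E⊆F []       = []
mapWalk E⊆F (w ∷ʳ e) = mapWalk E⊆F w ∷ʳ E⊆F _ _ e

-- Unfolding strong reachability

module _ (H : Graph) (σ : Fin (n H) → Fin (n H)) where

  inner-suc⁻ : ∀ {k v w} → T (inner H σ v (suc k) w) → T (inner H σ v k w) ⊎
    (σ v Fin.< σ w × ∃ λ x → T (inner H σ v k x) × T (adj H x w))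
  inner-suc⁻ {k} {v} {w} h with Equivalence.to (T-∨ {inner H σ v k w}) h
  ... | inj₁ h′ = inj₁ h′
  ... | inj₂ h′
    with v<w , h″ ← Equivalence.to (T-∧ {⌊ σ v Fin.<? σ w ⌋}) h′
    with x , h‴ ← anyV⁻ (λ x → inner H σ v k x ∧ adj H x w) h″ =
    inj₂ (toWitness {a? = σ v Fin.<? σ w} v<w , x , Equivalence.to (T-∧ {inner H σ v k x}) h‴)

  sreach-suc⁻ : ∀ {r v u} → T (sreach H σ (suc r) v u) → σ u Fin.≤ σ v ×
    (v ≡ u ⊎ ∃ λ x → T (inner H σ v r x) × T (adj H x u))
  sreach-suc⁻ {r} {v} {u} h
    with u≤v , h′ ← Equivalence.to (T-∧ {⌊ σ u Fin.≤? σ v ⌋}) h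
    with Equivalence.to (T-∨ {v == u}) h′
  ... | inj₁ v≡u = toWitness {a? = σ u Fin.≤? σ v} u≤v , inj₁ (toWitness {a? = v Fin.≟ u} v≡u)
  ... | inj₂ h″ with x , h‴ ← anyV⁻ (λ x → inner H σ v r x ∧ adj H x u) h″ =
    toWitness {a? = σ u Fin.≤? σ v} u≤v , inj₂ (x , Equivalence.to (T-∧ {inner H σ v r x}) h‴)

-- Induction and search on finite ranges

descend : ∀ {a} {A : ℕ → Set a} → (∀ j → A (suc j) → A j) → ∀ {i j} → i ≤ j → A j → A i
descend step {j = zero}  z≤n a = a
descend step {i} {suc j} i≤ a with m≤n⇒m<n∨m≡n i≤
... | inj₁ i<   = descend step (s≤s⁻¹ i<) (step j a)
... | inj₂ refl = a

least : ∀ {a} {A : ℕ → Set a} → Decidable A → ∀ {k} → A k →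
  ∃ λ j → j ≤ k × A j × (∀ {i} → i < j → ¬ A i)
least A? {zero}  a = zero , z≤n , a , λ ()
least A? {suc k} a with A? zero
... | yes a₀ = zero , z≤n , a₀ , λ ()
... | no ¬a₀ with j , j≤k , aⱼ , below ← least (A? ∘ suc) {k} a =
  suc j , s≤s j≤k , aⱼ , λ { {zero} _ → ¬a₀ ; {suc i} (s≤s i<j) → below i<j }

abstract
  pick : ∀ {n} {A : Fin n → Set} → Fin n → Decidable A → Fin n
  pick default A? with any? A?
  ... | yes (x , _) = x
  ... | no  _       = default

  pick-satisfies : ∀ {n} {A : Fin n → Set} default (A? : Decidable A) x → A x → A (pick default A?)
  pick-satisfies default A? x ax with any? A?
  ... | yes (_ , ay) = ay
  ... | no  none     = contradiction (x , ax) none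

  pick-preserves : ∀ {n} {A B : Fin n → Set} default (A? : Decidable A) →
    (∀ {x} → A x → B x) → B default → B (pick default A?)
  pick-preserves default A? A⊆B b with any? A?
  ... | yes (_ , ay) = A⊆B ay
  ... | no  _        = b

-- The merge sequence in reversed time

record ReversedMergeSeq (G : Graph) : Set where
  field
    end             : ℕ
    part            : ℕ → Partition (n G)
    red             : ℕ → PairSet (n G)
    coarsens        : ∀ j x y → part (suc j) x ≡ part (suc j) y → part j x ≡ part j y
    red-shrinks     : ∀ j x y → T (inR (red (suc j)) x y) → T (inR (red j) x y)
    whole           : Whole (part 0)
    part-singletons : ∀ {j x y} → end ≤ j → part j x ≡ part j y → x ≡ y
    homogeneous     : ∀ j → Homogeneous G (part j) (red j)

  part-coarsens : ∀ {i j x y} → i ≤ j → part j x ≡ part j y → part i x ≡ part i y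
  part-coarsens {x = x} {y} = descend (λ j → coarsens j x y)

  red-walk : ∀ {i j k x y} → i ≤ j → Walk (red j) k x y → Walk (red i) k x y
  red-walk i≤j = mapWalk (λ x y → descend {A = λ j → T (inR (red j) x y)} (λ j → red-shrinks j x y) i≤j)

  ReversedWidthAtMost : ℕ → ℕ → Set
  ReversedWidthAtMost r k = ∀ {i} → i < end → ∀ v → partsMeeting (Ball (red i) r v) (part (suc i)) ≤ k

module _ {G : Graph} (S : MergeSeq G) where

  private
    M : ℕ
    M = m S ∸ 1

    suc-M : suc M ≡ m S
    suc-M = m+[n∸m]≡n (m≥1 S)

    ∸-step : ∀ {j} → suc j ≤ M → M ∸ j ≡ suc (M ∸ suc j)
    ∸-step = +-∸-assoc 1

    later-exists : ∀ {j} → suc j ≤ M → suc (M ∸ suc j) < m S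
    later-exists {j} j<M = subst₂ _<_ (∸-step j<M) suc-M (s≤s (m∸n≤m M j))

    -- From step `M` on, truncated subtraction sends both indices to time 0, so the reversed
    -- sequence is constant there.
    forward : ∀ {a} (A : ℕ → Set a) → (∀ t → suc t < m S → A t → A (suc t)) →
      ∀ j → A (M ∸ suc j) → A (M ∸ j)
    forward A step j a with suc j ≤? M
    ... | yes j<M = subst A (sym (∸-step j<M)) (step _ (later-exists j<M) a)
    ... | no  j≮M = subst A (trans (m≤n⇒m∸n≡0 (m≤n⇒m≤1+n M≤j)) (sym (m≤n⇒m∸n≡0 M≤j))) a
      where
      M≤j : M ≤ j
      M≤j = s≤s⁻¹ (≰⇒> j≮M)

  reversed : ReversedMergeSeq G
  reversed = record
    { end             = M
    ; part            = λ j → P S (M ∸ j)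
    ; red             = λ j → R S (M ∸ j)
    ; coarsens        = λ j x y → forward (λ t → P S t x ≡ P S t y) (λ t lt → monoP S t lt x y) j
    ; red-shrinks     = λ j x y → forward (λ t → T (inR (R S t) x y)) (λ t lt → monoR S t lt x y) j
    ; whole           = last S M suc-M
    ; part-singletons = λ {_} {x} {y} M≤j eq →
        first S x y (subst (λ t → P S t x ≡ P S t y) (m≤n⇒m∸n≡0 M≤j) eq)
    ; homogeneous     = λ j → homog S (M ∸ j) (subst (M ∸ j <_) suc-M (s≤s (m∸n≤m M j)))
    }

  -- The width pairs a partition with the next red set; in reversed time this is `part (suc i)` with
  -- the larger set `red i`.
  reversed-width : ∀ r {k} → WidthAtMost S r k → ReversedMergeSeq.ReversedWidthAtMost reversed r k
  reversed-width r {k} width {i} i<M v =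
    subst (λ t → partsMeeting (Ball (R S t) r v) (P S (M ∸ suc i)) ≤ k)
      (sym (∸-step i<M)) (width (M ∸ suc i) (later-exists i<M) v)

-- Hubs and the quotient graph

module Construction {G : Graph} (S : ReversedMergeSeq G) where

  open ReversedMergeSeq S

  V : Set
  V = Fin (n G)

  D : ℕ → V → V → Set
  D = Walk (adj G)

  adj-edge : ∀ {x y} → T (adj G x y) → D 1 x y
  adj-edge a = edge (Equivalence.from T-∨ (inj₁ a))

  adj-flip : ∀ {x y} → T (adj G x y) → T (adj G y x)
  adj-flip {x} {y} = subst T (adj-sym G x y)

  adj-inR : ∀ {x y} → T (inR (adj G) x y) → T (adj G x y)
  adj-inR {x} {y} h with Equivalence.to (T-∨ {adj G x y}) h
  ... | inj₁ a = a
  ... | inj₂ a = adj-flip a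

  D-via : ∀ {x y z} → T (adj G x y) → T (adj G z y) → D 2 x z
  D-via a b = adj-edge a ◅◅ adj-edge (adj-flip b)

  -- At the last step every vertex counts as live; there the parts are singletons.
  Live : ℕ → V → Set
  Live j v = end ≤ j ⊎ ∃ λ y → T (adj G v y) × ¬ Walk (red j) 3 v y

  abstract
    live? : ∀ j → Decidable (Live j)
    live? j v = (end ≤? j) ⊎-dec any? (λ y → T? (adj G v y) ×-dec ¬? (walk? (red j) 3 v y))

  live-mono : ∀ {i j v} → i ≤ j → Live i v → Live j v
  live-mono i≤j (inj₁ end≤i)            = inj₁ (≤-trans end≤i i≤j)
  live-mono i≤j (inj₂ (y , a , far)) = inj₂ (y , a , far ∘ red-walk i≤j)

  dead-edge : ∀ {i v y} → ¬ Live i v → T (adj G v y) → Walk (red i) 3 v y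
  dead-edge {i} {v} {y} dead a = decidable-stable (walk? (red i) 3 v y) (λ far → dead (inj₂ (y , a , far)))

  -- A red pair `x`, `y` would itself be a short red walk, so `far` makes it non-red; homogeneity
  -- then transfers the edge to `z`, `y` unless that pair is red. For `z` equal to `y` the empty
  -- walk serves.
  red-or-adjacent : ∀ {j x y z} → T (adj G x y) → ¬ Walk (red j) 3 x y → part j z ≡ part j x →
    Walk (red j) 1 z y ⊎ T (adj G z y)
  red-or-adjacent {j} {x} {y} {z} a far same with z Fin.≟ y
  ... | yes refl = inj₁ []
  ... | no z≢y with inR (red j) z y in zy
  ...   | true  = inj₁ (edge (subst T (sym zy) _))
  ...   | false with inR (red j) x y in xy
  ...     | true  = contradiction (weaken (s≤s z≤n) (edge (subst T (sym xy) _))) far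
  ...     | false = inj₂ (subst T (homogeneous j x y z y x≢y z≢y (sym same) refl xy zy) a)
    where
    x≢y : x ≢ y
    x≢y refl = far []

  two-balls-cover : ∀ {j x x′} → Live j x → Live j x′ → part j x ≡ part j x′ → ¬ D 2 x x′ →
    ∀ z → part j z ≡ part j x → D 2 z x ⊎ D 2 z x′
  two-balls-cover (inj₁ end≤j) _ same apart
    with refl ← part-singletons end≤j same = contradiction [] apart
  two-balls-cover (inj₂ _) (inj₁ end≤j) same apart
    with refl ← part-singletons end≤j same = contradiction [] apart
  two-balls-cover (inj₂ (y , a , far)) (inj₂ (y′ , a′ , far′)) same apart z z~x
    with red-or-adjacent a far z~x | red-or-adjacent a′ far′ (trans z~x same) | red-or-adjacent a′ far′ same
  ... | inj₂ zy  | _        | _        = inj₁ (D-via zy a)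
  ... | inj₁ _   | inj₂ zy′ | _        = inj₂ (D-via zy′ a′)
  -- An edge from `x` to `y′` would put `x` within two steps of `x′`.
  ... | inj₁ _   | inj₁ _   | inj₂ xy′ = contradiction (D-via xy′ a′) apart
  ... | inj₁ zy  | inj₁ zy′ | inj₁ xy′ = contradiction (xy′ ◅◅ reverse zy′ ◅◅ zy) far

  -- The hubs of a part and their evolution

  record State : Set where
    constructor state-of
    field
      hub₁ hub₂ : V
      birth     : ℕ
  open State

  Covers : ℕ → State → V → Set
  Covers r s z = D r z (hub₁ s) ⊎ D r z (hub₂ s)

  LiveIn : ℕ → V → V → Set
  LiveIn j ℓ z = part j z ≡ ℓ × Live j z

  liveIn? : ∀ j ℓ → Decidable (LiveIn j ℓ)
  liveIn? j ℓ z = (part j z Fin.≟ ℓ) ×-dec live? j z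

  -- New hubs cover within 2 but are replaced only when they fail within 4. This slack absorbs a
  -- detour of length 2 and so bounds the number of changes.
  CoversLive : ℕ → V → State → Set
  CoversLive j ℓ s = ∀ z → LiveIn j ℓ z → Covers 4 s z

  abstract
    coversLive? : ∀ j ℓ s → Dec (CoversLive j ℓ s)
    coversLive? j ℓ s = all? (λ z → liveIn? j ℓ z
      →-dec (walk? (adj G) 4 z (hub₁ s) ⊎-dec walk? (adj G) 4 z (hub₂ s)))

  -- The label ℓ serves as a junk value when the part has no live vertex.
  firstHub : ℕ → V → V
  firstHub j ℓ = pick ℓ (liveIn? j ℓ)

  remote? : ∀ j ℓ → Decidable (λ z → LiveIn j ℓ z × ¬ D 2 (firstHub j ℓ) z)
  remote? j ℓ z = liveIn? j ℓ z ×-dec ¬? (walk? (adj G) 2 (firstHub j ℓ) z)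

  -- With no live vertex remote from the first hub, one hub suffices and is repeated.
  secondHub : ℕ → V → V
  secondHub j ℓ = pick (firstHub j ℓ) (remote? j ℓ)

  create : ℕ → V → State
  create j ℓ = state-of (firstHub j ℓ) (secondHub j ℓ) j

  firstHub-live : ∀ {j ℓ z} → LiveIn j ℓ z → LiveIn j ℓ (firstHub j ℓ)
  firstHub-live {j} {ℓ} {z} = pick-satisfies ℓ (liveIn? j ℓ) z

  secondHub-live : ∀ {j ℓ z} → LiveIn j ℓ z → LiveIn j ℓ (secondHub j ℓ)
  secondHub-live {j} {ℓ} l =
    pick-preserves {B = LiveIn j ℓ} (firstHub j ℓ) (remote? j ℓ) proj₁ (firstHub-live l)

  -- A live vertex far from the first hub witnesses that a remote one exists; then both hubs are
  -- live and apart, and `two-balls-cover` applies.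
  create-covers : ∀ {j ℓ} z → LiveIn j ℓ z → Covers 2 (create j ℓ) z
  create-covers {j} {ℓ} z l with walk? (adj G) 2 (firstHub j ℓ) z
  ... | yes near = inj₁ (reverse near)
  ... | no  far
    with h~ , hl ← firstHub-live l
    with (h′~ , h′l) , apart ← pick-satisfies (firstHub j ℓ) (remote? j ℓ) z (l , far)
    = two-balls-cover hl h′l (trans h~ (sym h′~)) apart z (trans (proj₁ l) (sym h~))

  -- Indexed by a vertex instead of a part, so that the state can be followed while the part of `v`
  -- shrinks; by `state-cong` only the part matters.
  state : ℕ → V → State
  state zero    v = create 0 (part 0 v)
  state (suc j) v = if does (coversLive? (suc j) (part (suc j) v) (state j v))
    then state j v else create (suc j) (part (suc j) v)

  state-step : ∀ j v →
    (CoversLive (suc j) (part (suc j) v) (state j v) × state (suc j) v ≡ state j v) ⊎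
    (¬ CoversLive (suc j) (part (suc j) v) (state j v) × state (suc j) v ≡ create (suc j) (part (suc j) v))
  state-step j v with coversLive? (suc j) (part (suc j) v) (state j v)
  ... | yes c = inj₁ (c , refl)
  ... | no ¬c = inj₂ (¬c , refl)

  state-cong : ∀ j {v w} → part j v ≡ part j w → state j v ≡ state j w
  state-cong zero    same = cong (create 0) same
  state-cong (suc j) {v} {w} same
    rewrite same | state-cong j {v} {w} (part-coarsens (n≤1+n j) same) = refl

  2≤4 : 2 ≤ 4
  2≤4 = s≤s (s≤s z≤n)

  state-covers : ∀ j v → CoversLive j (part j v) (state j v)
  state-covers zero v z l = Sum.map (weaken 2≤4) (weaken 2≤4) (create-covers z l)
  state-covers (suc j) v z l with state-step j v
  ... | inj₁ (c , eq) = subst (λ s → Covers 4 s z) (sym eq) (c z l)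
  ... | inj₂ (_ , eq) = subst (λ s → Covers 4 s z) (sym eq) (Sum.map (weaken 2≤4) (weaken 2≤4) (create-covers z l))

  birth-≤ : ∀ j v → birth (state j v) ≤ j
  birth-≤ zero    v = z≤n
  birth-≤ (suc j) v with state-step j v
  ... | inj₁ (_ , eq) = subst (λ s → birth s ≤ suc j) (sym eq) (m≤n⇒m≤1+n (birth-≤ j v))
  ... | inj₂ (_ , eq) = ≤-reflexive (cong birth eq)

  state-since : ∀ {i} j v → i ≤ j → birth (state j v) ≤ i → state j v ≡ state i v
  state-since zero    v z≤n _ = refl
  state-since {i} (suc j) v i≤ b≤ with m≤n⇒m<n∨m≡n i≤
  ... | inj₂ refl = refl
  ... | inj₁ i<   with state-step j v
  ...   | inj₁ (_ , eq) = trans eq (state-since j v (s≤s⁻¹ i<) (subst (λ s → birth s ≤ i) eq b≤))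
  ...   | inj₂ (_ , eq) = contradiction (<-≤-trans i< (subst (λ s → birth s ≤ i) eq b≤)) (n≮n i)

  -- A state born after step 0 replaced one that failed to cover the live vertices of its part. So
  -- there was a live vertex, and the hubs are not default values.
  hubs-live : ∀ {i} j v → birth (state j v) ≡ suc i →
    LiveIn (suc i) (part (suc i) v) (hub₁ (state j v)) × LiveIn (suc i) (part (suc i) v) (hub₂ (state j v))
  hubs-live {i} (suc j) v b≡ with state-step j v
  ... | inj₁ (_ , eq) = subst (λ s → LiveIn (suc i) _ (hub₁ s) × LiveIn (suc i) _ (hub₂ s)) (sym eq)
    (hubs-live j v (trans (cong birth (sym eq)) b≡))
  ... | inj₂ (¬c , eq) with any? (liveIn? (suc j) (part (suc j) v))
  ...   | no none = contradiction (λ z p → contradiction (z , p) none) ¬c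
  ...   | yes (_ , l) with refl ← trans (sym b≡) (cong birth eq) =
    subst (λ s → LiveIn (suc j) _ (hub₁ s) × LiveIn (suc j) _ (hub₂ s)) (sym eq)
      (firstHub-live l , secondHub-live l)

  -- Contracting each vertex to a hub

  everyone-live : ∀ v → Live end v
  everyone-live v = inj₁ ≤-refl

  private
    first-live : ∀ v → ∃ λ j → j ≤ end × Live j v × (∀ {i} → i < j → ¬ Live i v)
    first-live v = least (λ j → live? j v) (everyone-live v)

  abstract
    age : V → ℕ
    age v = proj₁ (first-live v)

    age-≤ : ∀ v → age v ≤ end
    age-≤ v = proj₁ (proj₂ (first-live v))

    age-live : ∀ v → Live (age v) v
    age-live v = proj₁ (proj₂ (proj₂ (first-live v)))

    age-least : ∀ {i} v → i < age v → ¬ Live i v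
    age-least v = proj₂ (proj₂ (proj₂ (first-live v)))

  home : V → State
  home v = state (age v) v

  born : V → ℕ
  born v = birth (home v)

  abstract
    centre : V → V
    centre v with walk? (adj G) 4 v (hub₁ (home v))
    ... | yes _ = hub₁ (home v)
    ... | no  _ = hub₂ (home v)

    centre-near : ∀ v → D 4 v (centre v)
    centre-near v with walk? (adj G) 4 v (hub₁ (home v))
    ... | yes w = w
    ... | no far with state-covers (age v) v v (refl , age-live v)
    ...   | inj₁ w = contradiction w far
    ...   | inj₂ w = w

    centre-is-hub : ∀ v → centre v ≡ hub₁ (home v) ⊎ centre v ≡ hub₂ (home v)
    centre-is-hub v with walk? (adj G) 4 v (hub₁ (home v))
    ... | yes _ = inj₁ refl
    ... | no  _ = inj₂ refl

  -- The birth belongs to the label: all members of a class are dead before it, and the classes will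
  -- be ordered by it.
  node : V → V × ℕ
  node v = centre v , born v

  born-≤ : ∀ v → born v ≤ end
  born-≤ v = ≤-trans (birth-≤ (age v) v) (age-≤ v)

  -- The state that receives `v` is born no later than the step at which `v` becomes live.
  dead-before-birth : ∀ {i} v → i < born v → ¬ Live i v
  dead-before-birth v i< = age-least v (<-≤-trans i< (birth-≤ (age v) v))

  centre-live : ∀ {i} v → born v ≡ suc i → LiveIn (suc i) (part (suc i) v) (centre v)
  centre-live {i} v b≡ with centre-is-hub v | hubs-live (age v) v b≡
  ... | inj₁ eq | l , _ = subst (LiveIn (suc i) _) (sym eq) l
  ... | inj₂ eq | _ , l = subst (LiveIn (suc i) _) (sym eq) l

  -- Both vertices are joined, within three red steps, to the non-red neighbour that keeps the centre live.
  node-red-diameter : ∀ {i v w} → i < born v → node v ≡ node w → Walk (red i) 6 v w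
  node-red-diameter {i} {v} {w} i< same with born v in b≡
  ... | suc i′ = red-walk (s≤s⁻¹ i<) close
    where
    bw≡ : born w ≡ suc i′
    bw≡ = sym (cong proj₂ same)
    v~ : part (suc i′) (centre v) ≡ part (suc i′) v
    v~ = proj₁ (centre-live v b≡)
    w~ : part (suc i′) (centre v) ≡ part (suc i′) w
    w~ = trans (cong (part (suc i′)) (cong proj₁ same)) (proj₁ (centre-live w bw≡))
    close : Walk (red i′) 6 v w
    close with proj₂ (centre-live v b≡)
    ... | inj₁ end≤ with refl ← part-singletons end≤ (trans (sym v~) w~) = []
    ... | inj₂ (y , a , far) = attach v v~ b≡ ◅◅ reverse (attach w w~ bw≡)
      where
      attach : ∀ x → part (suc i′) (centre v) ≡ part (suc i′) x → born x ≡ suc i′ → Walk (red i′) 3 x y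
      attach x x~ bx≡ with red-or-adjacent a far (sym x~)
      ... | inj₁ short = weaken (s≤s z≤n) (red-walk (n≤1+n i′) short)
      ... | inj₂ xy    = dead-edge (dead-before-birth x (≤-reflexive (sym bx≡))) xy

  node-diameter : ∀ {v w} → node v ≡ node w → D 8 v w
  node-diameter {v} {w} same =
    subst (D 4 v) (cong proj₁ same) (centre-near v) ◅◅ reverse (centre-near w)

  -- Stages of the state of the part of u once u is live, indexed by a bound on the number of states so far: after
  -- the first change the first hub is near u, or else two remote live vertices already cover the part for good.
  data Phase (u : V) (k : ℕ) : ℕ → Set where
    initial : Phase u k 1
    near    : D 2 u (hub₁ (state k u)) → Phase u k 2
    settled : (∀ w → part k w ≡ part k u → Covers 4 (state k u) w) → Phase u k 3

  phase-≤ : ∀ {u k b} → Phase u k b → b ≤ 3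
  phase-≤ initial     = s≤s z≤n
  phase-≤ (near _)    = s≤s (s≤s z≤n)
  phase-≤ (settled _) = ≤-refl

  phase-inherit : ∀ {u k b} → state (suc k) u ≡ state k u → Phase u k b → Phase u (suc k) b
  phase-inherit eq initial     = initial
  phase-inherit {u} eq (near d) = near (subst (λ s → D 2 u (hub₁ s)) (sym eq) d)
  phase-inherit eq (settled c) = settled λ w same →
    subst (λ s → Covers 4 s w) (sym eq) (c w (part-coarsens (n≤1+n _) same))

  settled-covers : ∀ {u k} s → (∀ w → part k w ≡ part k u → Covers 4 s w) →
    CoversLive (suc k) (part (suc k) u) s
  settled-covers s c z (z~u , _) = c z (part-coarsens (n≤1+n _) z~u)

  -- Each vertex of the part, live or dead, is within 2 of `u` or `w`, and these live vertices are
  -- within 2 of a new hub. As dead vertices are covered too, their becoming live later does no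
  -- harm.
  remote-settles : ∀ {u w j} → Live j u → LiveIn j (part j u) w → ¬ D 2 u w →
    ∀ z → part j z ≡ part j u → Covers 4 (create j (part j u)) z
  remote-settles {u} {w} {j} ul l@(w~u , wl) far z z~u with two-balls-cover ul wl (sym w~u) far z z~u
  ... | inj₁ d = Sum.map (d ◅◅_) (d ◅◅_) (create-covers u (refl , ul))
  ... | inj₂ d = Sum.map (d ◅◅_) (d ◅◅_) (create-covers w l)

  -- A phase that would have kept the hubs is excluded, and the new phase is strictly later: settled
  -- if some live vertex is remote from `u`, otherwise near, since the new first hub is itself live.
  phase-change : ∀ {u k b} → Live (suc k) u → ¬ CoversLive (suc k) (part (suc k) u) (state k u) →
    state (suc k) u ≡ create (suc k) (part (suc k) u) →
    Phase u k b → ∃ λ b′ → b < b′ × Phase u (suc k) b′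
  phase-change {u} {k} {b} ul ¬c eq ph
    with any? (λ w → liveIn? (suc k) (part (suc k) u) w ×-dec ¬? (walk? (adj G) 2 u w))
  ... | yes (w , l , far) = 3 , unsettled ph , settled λ z z~u →
    subst (λ s → Covers 4 s z) (sym eq) (remote-settles ul l far z z~u)
    where
    unsettled : Phase u k b → b < 3
    unsettled initial     = s≤s (s≤s z≤n)
    unsettled (near _)    = ≤-refl
    unsettled (settled c) = contradiction (settled-covers (state k u) c) ¬c
  ... | no none = gather ph
    where
    all-near : ∀ z → LiveIn (suc k) (part (suc k) u) z → D 2 u z
    all-near z l = decidable-stable (walk? (adj G) 2 u z) (λ far → none (z , l , far))
    gather : Phase u k b → ∃ λ b′ → b < b′ × Phase u (suc k) b′
    gather initial     = 2 , ≤-refl ,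
      near (subst (λ s → D 2 u (hub₁ s)) (sym eq) (all-near _ (firstHub-live (refl , ul))))
    -- All live vertices are within 2 of `u`, which is within 2 of the old first hub, so the old
    -- state still covers.
    gather (near d)    = contradiction (λ z l → inj₁ (reverse (all-near z l) ◅◅ d)) ¬c
    gather (settled c) = contradiction (settled-covers (state k u) c) ¬c

  -- The list grows only when the state changes, and each change raises the phase index; hence the
  -- index bounds the length.
  history : ∀ {u i} → Live i u → ∀ d → ∃ λ L → ∃ λ b → length L ≤ b × Phase u (d + i) b ×
    (∀ s → i ≤ s → s ≤ d + i → state s u ∈ L)
  history {u} {i} ul zero = state i u ∷ [] , 1 , ≤-refl , initial ,
    λ s i≤s s≤i → here (cong (λ t → state t u) (≤-antisym s≤i i≤s))
  history {u} {i} ul (suc d) with history ul d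
  ... | L , b , len , ph , mem with state-step (d + i) u
  ...   | inj₁ (_ , eq) = L , b , len , phase-inherit eq ph , mem′
    where
    mem′ : ∀ s → i ≤ s → s ≤ suc d + i → state s u ∈ L
    mem′ s i≤s s≤ with m≤n⇒m<n∨m≡n s≤
    ... | inj₁ s<   = mem s i≤s (s≤s⁻¹ s<)
    ... | inj₂ refl = subst (_∈ L) (sym eq) (mem (d + i) (m≤n+m i d) ≤-refl)
  ...   | inj₂ (¬c , eq) with b′ , b<b′ , ph′ ← phase-change (live-mono (m≤n+m i (suc d)) ul) ¬c eq ph =
    state (suc d + i) u ∷ L , b′ , ≤-trans (s≤s len) b<b′ , ph′ , mem′
    where
    mem′ : ∀ s → i ≤ s → s ≤ suc d + i → state s u ∈ state (suc d + i) u ∷ L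
    mem′ s i≤s s≤ with m≤n⇒m<n∨m≡n s≤
    ... | inj₁ s<   = there (mem s i≤s (s≤s⁻¹ s<))
    ... | inj₂ refl = here refl

  -- Older classes meeting a part

  home-since : ∀ {j} w → j < age w → born w ≤ j → home w ≡ state j w
  home-since w j< b≤ = state-since (age w) w (<⇒≤ j<) b≤

  -- No vertex of the part becomes live before the first live one, `u`. From then on `u` sees few
  -- states, and up to step `j` the vertices of the part share their states with `u`.
  few-homes : ∀ j z → ∃ λ L → length L ≤ 3 ×
    (∀ w → part j w ≡ part j z → born w ≤ j → home w ∈ L)
  few-homes j z
    with i , _ , (u , u~z , ul) , earliest ←
      least (λ i → any? (λ u → (part j u Fin.≟ part j z) ×-dec live? i u)) (z , refl , everyone-live z)
    with i ≤? j
  ... | no i≰j = state j z ∷ [] , s≤s z≤n , λ w w~z b≤ → here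
    (trans (home-since w (<-≤-trans (≰⇒> i≰j) (≮⇒≥ (λ lt → earliest lt (w , w~z , age-live w)))) b≤)
           (state-cong j w~z))
  ... | yes i≤j with L , _ , len , ph , mem ← history ul (j ∸ i) =
    L , ≤-trans len (phase-≤ ph) , λ w w~z b≤ → found w w~z b≤
    where
    mem′ : ∀ s → i ≤ s → s ≤ j → state s u ∈ L
    mem′ s i≤s s≤j = mem s i≤s (subst (s ≤_) (sym (m∸n+n≡m i≤j)) s≤j)
    found : ∀ w → part j w ≡ part j z → born w ≤ j → home w ∈ L
    found w w~z b≤ with age w ≤? j
    ... | yes age≤ = subst (_∈ L) (state-cong (age w) (part-coarsens age≤ (trans u~z (sym w~z))))
                       (mem′ (age w) (≮⇒≥ (λ lt → earliest lt (w , w~z , age-live w))) age≤)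
    -- If `w` becomes live only after step `j`, its home, born by `j`, is still the state at `j`.
    ... | no  age≰ = subst (_∈ L) (trans (state-cong j (trans u~z (sym w~z))) (sym (home-since w (≰⇒> age≰) b≤)))
                       (mem′ j i≤j ≤-refl)

  nodes-of : State → List (V × ℕ)
  nodes-of s = (hub₁ s , birth s) ∷ (hub₂ s , birth s) ∷ []

  node∈nodes-of : ∀ v → node v ∈ nodes-of (home v)
  node∈nodes-of v with centre-is-hub v
  ... | inj₁ eq = here (cong (_, born v) eq)
  ... | inj₂ eq = there (here (cong (_, born v) eq))

  -- There are at most three states, with two hubs each.
  few-nodes : ∀ j ℓ → ∃ λ L → length L ≤ 6 × (∀ w → part j w ≡ ℓ → born w ≤ j → node w ∈ L)
  few-nodes j ℓ with any? (λ z → part j z Fin.≟ ℓ)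
  ... | no none = [] , z≤n , λ w w~ _ → contradiction (w , w~) none
  ... | yes (z , refl) with L , len , mem ← few-homes j z =
    concatMap nodes-of L ,
    ≤-trans (length-concatMap-≤ nodes-of 2 (λ _ → ≤-refl) L) (*-monoʳ-≤ 2 len) ,
    λ w w~ b≤ → ∈-concatMap⁺ nodes-of (lose (mem w w~ b≤) (node∈nodes-of w))

  -- The quotient graph and the quasi-isometry

  abstract
    nodes : Quotient node
    nodes = quotient (≡-dec Fin._≟_ _≟_) node

  open Quotient nodes

  same-class : ∀ {x y} → class x ≡ class y → node x ≡ node y
  same-class {x} {y} eq = trans (sym (label-class x)) (trans (cong label eq) (label-class y))

  weight : Fin size → ℕ
  weight = proj₂ ∘ label

  weight-class : ∀ x → weight (class x) ≡ born x
  weight-class x = cong proj₂ (label-class x)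

  Adjacent : Fin size → Fin size → Set
  Adjacent a b = a ≢ b × ∃ λ x → ∃ λ y → class x ≡ a × class y ≡ b × T (adj G x y)

  abstract
    adjacent? : ∀ a b → Dec (Adjacent a b)
    adjacent? a b = ¬? (a Fin.≟ b) ×-dec
      any? (λ x → any? (λ y → (class x Fin.≟ a) ×-dec ((class y Fin.≟ b) ×-dec T? (adj G x y))))

  adjacent-flip : ∀ {a b} → Adjacent a b → Adjacent b a
  adjacent-flip (a≢b , x , y , x∈ , y∈ , xy) = a≢b ∘ sym , y , x , y∈ , x∈ , adj-flip xy

  H : Graph
  H = record
    { n      = size
    ; adj    = λ a b → ⌊ adjacent? a b ⌋
    ; sym    = λ a b → trans (isYes≗does (adjacent? a b)) (trans
        (does-⇔ (mk⇔ adjacent-flip adjacent-flip) (adjacent? a b) (adjacent? b a))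
        (sym (isYes≗does (adjacent? b a))))
    ; irrefl = λ a → trans (isYes≗does (adjacent? a a))
        (dec-false (adjacent? a a) (λ adjacent → proj₁ adjacent refl))
    }

  H-edge : ∀ {a b} → T (inR (adj H) a b) → Adjacent a b
  H-edge {a} {b} h with Equivalence.to (T-∨ {adj H a b}) h
  ... | inj₁ e = toWitness e
  ... | inj₂ e = adjacent-flip (toWitness e)

  -- A walk with `k` edges visits `k + 1` classes, each of diameter at most 8, whence `k * 9 + 8`.
  H-to-G : ∀ {k a b x y} → class x ≡ a → class y ≡ b → Walk (adj H) k a b → D (k * 9 + 8) x y
  H-to-G {k} x∈ y∈ [] = weaken (m≤n+m 8 (k * 9)) (node-diameter (same-class (trans x∈ (sym y∈))))
  H-to-G {suc k} {x = x} {y} x∈ y∈ (w ∷ʳ e) with _ , p , q , p∈ , q∈ , pq ← H-edge e =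
    subst (λ l → D l x y) (trans (+-comm (k * 9 + 8) 9) (sym (+-assoc 9 (k * 9) 8)))
      (H-to-G x∈ p∈ w ◅◅ adj-edge pq ◅◅ node-diameter (same-class (trans q∈ (sym y∈))))

  G-to-H : ∀ {k x y} → D k x y → Walk (adj H) k (class x) (class y)
  G-to-H [] = []
  G-to-H {x = x} (_∷ʳ_ {k} {y = y} {z} w e) with class y Fin.≟ class z
  ... | yes same = weaken (n≤1+n k) (subst (Walk (adj H) k (class x)) same (G-to-H w))
  ... | no  diff = G-to-H w ∷ʳ Equivalence.from (T-∨ {adj H (class y) (class z)})
    (inj₁ (fromWitness (diff , y , z , refl , refl , adj-inR e)))

  quasi-isometry : QuasiIsometric 13 12 G H
  quasi-isometry = class
    , (λ x y k h → walk⇒reach (weaken (bound k) (H-to-G refl refl (reach⇒walk {E = adj H} k h))))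
    , (λ x y k h → walk⇒reach (weaken (≤-trans (m≤n*m k 13) (m≤m+n (13 * k) 12))
                                      (G-to-H (reach⇒walk {E = adj G} k h))))
    , (λ b → member b , walk⇒reach (subst (Walk (adj H) 12 b) (sym (class-member b)) []))
    where
    bound : ∀ k → k * 9 + 8 ≤ 13 * (k + 12)
    bound k = begin
      -- 148 completes 8 to `12 * 13`.
      k * 9 + 8         ≤⟨ +-mono-≤ (*-monoʳ-≤ k (m≤m+n 9 4)) (m≤m+n 8 148) ⟩
      k * 13 + 12 * 13  ≡⟨ *-distribʳ-+ 13 k 12 ⟨
      (k + 12) * 13     ≡⟨ *-comm (k + 12) 13 ⟩
      13 * (k + 12)     ∎
      where open ≤-Reasoning

  -- Strong colouring numbers of the quotient

  σ : Fin size → Fin size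
  σ = rank weight

  edge-red : ∀ {i x y} → i < weight (class x) → T (adj G x y) → Walk (red i) 3 x y
  edge-red {i} {x} i< = dead-edge (dead-before-birth x (subst (i <_) (weight-class x) i<))

  class-red : ∀ {i a x y} → i < weight a → class x ≡ a → class y ≡ a → Walk (red i) 6 x y
  class-red {i} {x = x} i< refl y∈ =
    node-red-diameter (subst (i <_) (weight-class x) i<) (same-class (sym y∈))

  -- Inner vertices follow `a` in the order, so their weights also exceed `i`: at step `i` each
  -- class on the way has red diameter at most 6 and each edge red length at most 3. With `k + 1`
  -- classes this gives `k * 9 + 6`.
  inner-red : ∀ {i a x} → i < weight a → class x ≡ a → ∀ k c → T (inner H σ a k c) →
    i < weight c × (∀ y → class y ≡ c → Walk (red i) (k * 9 + 6) x y)
  inner-red {a = a} i< x∈ zero c h with refl ← toWitness {a? = a Fin.≟ c} h =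
    i< , λ y y∈ → class-red i< x∈ y∈
  inner-red {i} {a} {x} i< x∈ (suc k) c h with inner-suc⁻ H σ {k} h
  ... | inj₁ h′ with i<c , w ← inner-red i< x∈ k c h′ =
    i<c , λ y y∈ → weaken (+-monoˡ-≤ 6 (m≤n+m (k * 9) 9)) (w y y∈)
  ... | inj₂ (a<c , b , ib , bc)
    with i<b , w ← inner-red i< x∈ k b ib
    with _ , p , q , refl , q∈ , pq ← toWitness {a? = adjacent? b c} bc =
    i<c , λ y y∈ → subst (λ l → Walk (red i) l x y)
      (trans (+-comm (k * 9 + 6) 9) (sym (+-assoc 9 (k * 9) 6)))
      (w p refl ◅◅ edge-red i<b pq ◅◅ class-red i<c q∈ y∈)
    where
    i<c : i < weight c
    i<c = <-≤-trans i< (rank-reflects-≤ weight a c (<⇒≤ a<c))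

  sreach-weight : ∀ r a c → T (sreach H σ r a c) → weight c ≤ weight a
  sreach-weight zero    a c h with refl ← toWitness {a? = a Fin.≟ c} h = ≤-refl
  sreach-weight (suc r) a c h = rank-reflects-≤ weight c a (proj₁ (sreach-suc⁻ H σ {r} h))

  -- The class `c` may be born by step `i`, so its red diameter is not controlled. Only the vertex
  -- `y` where the last edge arrives is reached; that edge is short because its other end is dead at
  -- step `i`.
  sreach-red : ∀ {i x} r a c → i < weight a → class x ≡ a → T (sreach H σ r a c) →
    ∃ λ y → class y ≡ c × Walk (red i) (r * 9) x y
  sreach-red {x = x} zero a c i< x∈ h with refl ← toWitness {a? = a Fin.≟ c} h = x , x∈ , []
  sreach-red {i} {x} (suc r) a c i< x∈ h with sreach-suc⁻ H σ {r} h
  ... | _ , inj₁ refl = x , x∈ , []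
  ... | _ , inj₂ (b , ib , bc)
    with i<b , w ← inner-red i< x∈ r b ib
    with _ , p , q , refl , q∈ , pq ← toWitness {a? = adjacent? b c} bc =
    q , q∈ , subst (λ l → Walk (red i) l x q) (trans (+-assoc (r * 9) 6 3) (+-comm (r * 9) 9))
      (w p refl ◅◅ edge-red i<b pq)

  -- The step before the birth of `a` supplies the red ball, the step of its birth the parts: each
  -- part met by the ball meets at most 6 classes no younger than `a`.
  scol : ∀ r {k} → ReversedWidthAtMost (r * 9) k → ∀ a → count (sreach H σ r a) ≤ 6 + 6 * k
  scol r {k} width a with weight a in wa
  -- No step precedes birth 0, but `part 0` is the whole vertex set, so at most 6 classes are born
  -- at 0. This is the summand 6.
  ... | zero = ≤-trans
    (count-≤-length (sreach H σ r a) label-injective L λ c h →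
      subst (_∈ L) (trans (sym (label-class (member c))) (cong label (class-member c)))
        (mem (member c) (whole _ _) (born-member c h)))
    (≤-trans len (m≤m+n 6 (6 * k)))
    where
    found : ∃ λ L → length L ≤ 6 × (∀ w → part 0 w ≡ part 0 (member a) → born w ≤ 0 → node w ∈ L)
    found = few-nodes 0 (part 0 (member a))
    L = proj₁ found
    len = proj₁ (proj₂ found)
    mem = proj₂ (proj₂ found)
    born-member : ∀ c → T (sreach H σ r a c) → born (member c) ≤ 0
    born-member c h = subst₂ _≤_ (trans (cong weight (sym (class-member c))) (weight-class (member c))) wa
      (sreach-weight r a c h)
  ... | suc i = begin
    count (sreach H σ r a)
      ≤⟨ count-≤-length (sreach H σ r a) label-injective L listed ⟩
    length L
      ≤⟨ length-concatMap-≤ local 6 (λ ℓ → proj₁ (proj₂ (few-nodes (suc i) ℓ))) met ⟩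
    6 * partsMeeting (Ball (red i) (r * 9) x) (part (suc i))
      ≤⟨ *-monoʳ-≤ 6 (width i<end x) ⟩
    6 * k
      ≤⟨ m≤n+m (6 * k) 6 ⟩
    6 + 6 * k ∎
    where
    open ≤-Reasoning
    x : V
    x = member a
    i<end : i < end
    i<end = subst (_≤ end) (trans (sym (weight-class x)) (trans (cong weight (class-member a)) wa)) (born-≤ x)
    meets : V → Bool
    meets ℓ = anyV (λ y → Ball (red i) (r * 9) x y ∧ (part (suc i) y == ℓ))
    met : List V
    met = filterᵇ meets (allFin (n G))
    local : V → List (V × ℕ)
    local ℓ = proj₁ (few-nodes (suc i) ℓ)
    L : List (V × ℕ)
    L = concatMap local met
    listed : ∀ c → T (sreach H σ r a c) → label c ∈ L
    listed c h with y , refl , w ← sreach-red {i} {x} r a c (≤-reflexive (sym wa)) (class-member a) h =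
      subst (_∈ L) (sym (label-class y)) (∈-concatMap⁺ local (lose
        (∈-selected⁺ meets (anyV⁺ (λ z → Ball (red i) (r * 9) x z ∧ (part (suc i) z == part (suc i) y)) y
          (Equivalence.from (T-∧ {Ball (red i) (r * 9) x y}) (walk⇒reach w , fromWitness refl))))
        (proj₂ (proj₂ (few-nodes (suc i) (part (suc i) y))) y refl
          (subst₂ _≤_ (weight-class y) wa (sreach-weight r a (class y) h)))))

theorem1p6 : (𝒞 : GraphClass) → UniversallyBoundedMergeWidth 𝒞 →
    Σ GraphClass λ 𝒟 → BoundedExpansion 𝒟 ×
    (∀ G → 𝒞 G → Σ Graph λ H → 𝒟 H × QuasiIsometric 13 12 G H)
theorem1p6 𝒞 (f , bounded) =
  -- The class is cut out by the bounds themselves, so bounded expansion is immediate. One `H` must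
  -- then meet the bounds for all radii, which a single merge sequence for all radii provides.
  (λ H → ∀ r → ScolAtMost r H (6 + 6 * f (r * 9))) ,
  (λ r → 6 + 6 * f (r * 9) , λ H scol≤ → scol≤ r) ,
  λ G G∈𝒞 → let (S , width) = bounded G G∈𝒞
                open Construction (reversed S) in
    H , (λ r → σ , rank-injective weight , scol r (reversed-width S (r * 9) (width (r * 9)))) , quasi-isometry
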